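{- Let $\mathbb{F}$ be a field, let $s,t\in\mathbb{N}$ with $s,t\ge 2$, and let $n\ge s\cdot t^4$ be an integer. Let $U$ be an $n$-dimensional vector space over $\mathbb{F}$. Then for any linear subspace $\mathcal{A}\le\Lambda(U)$, either there exists a subspace $V\le U$ with $\dim(V)=s$ such that $\mathcal{A}|_V$ is the zero space, or there exists a subspace $W\le U$ with $\dim(W)=t$ such that $\mathcal{A}|_W=\Lambda(W)$.
   Context: For a vector space $U$ over a field $\mathbb{F}$, a bilinear form $f:U\times U\to\mathbb{F}$ is alternating if $f(u,u)=0$ for all $u\in U$. $\Lambda(U)$ denotes the $\mathbb{F}$-linear space of all alternating bilinear forms on $U$. The notation $W\le U$ means that $W$ is a linear subspace of $U$. For $W\le U$, $f|_W:W\times W\to\mathbb{F}$ is the restriction of $f$ to $W$, and for $\mathcal{A}\le\Lambda(U)$, $\mathcal{A}|_W:=\{f|_W\mid f\in\mathcal{A}\}\le\Lambda(W)$. -}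

module Defs where

open import Algebra.Bundles using (CommutativeRing)
open import Algebra.Definitions using (Invertible)
open import Algebra.Module.Bundles using (Module)
open import Algebra.Module.Structures.Biased using (IsModuleFromLeft)
open import Data.Nat.Base using (ℕ)
open import Data.Product.Base using (Σ; Σ-syntax; ∃-syntax; _×_; _,_; proj₁; proj₂)
open import Data.Vec.Functional using (Vector)
open import Function.Base using (flip)
open import Level using (Level; _⊔_; suc)
open import Relation.Binary.Definitions using (_Respects_)
open import Relation.Nullary.Negation using (¬_)
open import Relation.Unary using (Pred; _≐_)
import Algebra.Properties.CommutativeMonoid.Sum as Sum
import Relation.Binary.Reasoning.Setoid as SetoidReasoning

private
  variable
    c ℓ m ℓm p q : Level

record IsField (R : CommutativeRing c ℓ) : Set (c ⊔ ℓ) where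
  open CommutativeRing R
  field
    1≉0        : ¬ (1# ≈ 0#)
    invertible : ∀ x → ¬ (x ≈ 0#) → Invertible _≈_ 1# _*_ x

VectorSpace : CommutativeRing c ℓ → (m ℓm : Level) → Set (c ⊔ ℓ ⊔ suc (m ⊔ ℓm))
VectorSpace 𝔽 m ℓm = Module 𝔽 m ℓm

module _ {𝔽 : CommutativeRing c ℓ} where

  private
    module 𝔽 = CommutativeRing 𝔽

  module _ (U : VectorSpace 𝔽 m ℓm) where

    open Module U
    open Sum +ᴹ-commutativeMonoid using (sum)

    linearCombination : ∀ {n} → Vector 𝔽.Carrier n → Vector Carrierᴹ n → Carrierᴹ
    linearCombination a b = sum λ i → a i *ₗ b i

    LinearlyIndependent : ∀ {n} → Vector Carrierᴹ n → Set (c ⊔ ℓ ⊔ ℓm)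
    LinearlyIndependent b = ∀ a → linearCombination a b ≈ᴹ 0ᴹ → ∀ i → a i 𝔽.≈ 𝔽.0#

    Spanning : ∀ {n} → Vector Carrierᴹ n → Set (c ⊔ m ⊔ ℓm)
    Spanning b = ∀ x → ∃[ a ] x ≈ᴹ linearCombination a b

    HasDimension : ℕ → Set (c ⊔ ℓ ⊔ m ⊔ ℓm)
    HasDimension n = Σ[ b ∈ Vector Carrierᴹ n ] LinearlyIndependent b × Spanning b

    record Subspace (p : Level) : Set (c ⊔ m ⊔ ℓm ⊔ suc p) where
      field
        Member  : Pred Carrierᴹ p
        resp    : Member Respects _≈ᴹ_
        0-mem   : Member 0ᴹ
        +-mem   : ∀ {x y} → Member x → Member y → Member (x +ᴹ y)
        *-mem   : ∀ k {x} → Member x → Member (k *ₗ x)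

  open Subspace public using (Member)

  module _ {U : VectorSpace 𝔽 m ℓm} where

    open Module U

    -- Negation is scaling by -1, since closure under it is not a field of
    -- Subspace.
    ⟦_⟧ : Subspace U p → VectorSpace 𝔽 (m ⊔ p) ℓm
    ⟦ W ⟧ = record
      { Carrierᴹ = Σ Carrierᴹ (Member W)
      ; _≈ᴹ_ = λ x y → proj₁ x ≈ᴹ proj₁ y
      ; _+ᴹ_ = λ (x , x∈) (y , y∈) → x +ᴹ y , +-mem x∈ y∈
      ; _*ₗ_ = λ k (x , x∈) → k *ₗ x , *-mem k x∈
      ; _*ᵣ_ = λ (x , x∈) k → k *ₗ x , *-mem k x∈
      ; 0ᴹ = 0ᴹ , 0-mem
      ; -ᴹ_ = λ (x , x∈) → (𝔽.- 𝔽.1#) *ₗ x , *-mem (𝔽.- 𝔽.1#) x∈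
      ; isModule = IsModuleFromLeft.isModule {commutativeRing = 𝔽} record
        { isLeftModule = record
          { isLeftSemimodule = record
            { +ᴹ-isCommutativeMonoid = record
              { isMonoid = record
                { isSemigroup = record
                  { isMagma = record
                    { isEquivalence = record
                      { refl = ≈ᴹ-refl ; sym = ≈ᴹ-sym ; trans = ≈ᴹ-trans }
                    ; ∙-cong = +ᴹ-cong
                    }
                  ; assoc = λ _ _ _ → +ᴹ-assoc _ _ _
                  }
                ; identity = (λ _ → +ᴹ-identityˡ _) , (λ _ → +ᴹ-identityʳ _)
                }
              ; comm = λ _ _ → +ᴹ-comm _ _
              }
            ; isPreleftSemimodule = record
              { *ₗ-cong = *ₗ-cong
              ; *ₗ-zeroˡ = λ _ → *ₗ-zeroˡ _
              ; *ₗ-distribʳ = λ _ _ _ → *ₗ-distribʳ _ _ _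
              ; *ₗ-identityˡ = λ _ → *ₗ-identityˡ _
              ; *ₗ-assoc = λ _ _ _ → *ₗ-assoc _ _ _
              ; *ₗ-zeroʳ = λ _ → *ₗ-zeroʳ _
              ; *ₗ-distribˡ = λ _ _ _ → *ₗ-distribˡ _ _ _
              }
            }
          ; -ᴹ‿cong = *ₗ-cong 𝔽.refl
          ; -ᴹ‿inverse = (λ (x , _) → inverseˡ x)
                       , (λ (x , _) → ≈ᴹ-trans (+ᴹ-comm _ _) (inverseˡ x))
          }
        }
      }
      where
      open Subspace W
      open SetoidReasoning ≈ᴹ-setoid

      inverseˡ : ∀ x → (𝔽.- 𝔽.1#) *ₗ x +ᴹ x ≈ᴹ 0ᴹ
      inverseˡ x = begin
        (𝔽.- 𝔽.1#) *ₗ x +ᴹ x            ≈⟨ +ᴹ-cong ≈ᴹ-refl (*ₗ-identityˡ x) ⟨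
        (𝔽.- 𝔽.1#) *ₗ x +ᴹ 𝔽.1# *ₗ x    ≈⟨ *ₗ-distribʳ x _ _ ⟨
        (𝔽.- 𝔽.1# 𝔽.+ 𝔽.1#) *ₗ x        ≈⟨ *ₗ-cong (𝔽.-‿inverseˡ 𝔽.1#) ≈ᴹ-refl ⟩
        𝔽.0# *ₗ x                       ≈⟨ *ₗ-zeroˡ x ⟩
        0ᴹ                              ∎

    IsZeroSpace : Subspace U p → Set (m ⊔ ℓm ⊔ p)
    IsZeroSpace W = Member W ≐ (_≈ᴹ 0ᴹ)

    IsWholeSpace : Subspace U p → Set (m ⊔ p)
    IsWholeSpace W = ∀ x → Member W x

  -- Homogeneity mentions only _*ₗ_: in a Module it coincides with _*ᵣ_.
  record AlternatingForm (U : VectorSpace 𝔽 m ℓm) : Set (c ⊔ ℓ ⊔ m ⊔ ℓm) where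
    open Module U
    field
      form        : Carrierᴹ → Carrierᴹ → 𝔽.Carrier
      cong        : ∀ {x x′ y y′} → x ≈ᴹ x′ → y ≈ᴹ y′ → form x y 𝔽.≈ form x′ y′
      +-linearˡ   : ∀ x x′ y → form (x +ᴹ x′) y 𝔽.≈ form x y 𝔽.+ form x′ y
      *-linearˡ   : ∀ k x y → form (k *ₗ x) y 𝔽.≈ k 𝔽.* form x y
      +-linearʳ   : ∀ x y y′ → form x (y +ᴹ y′) 𝔽.≈ form x y 𝔽.+ form x y′
      *-linearʳ   : ∀ k x y → form x (k *ₗ y) 𝔽.≈ k 𝔽.* form x y
      alternating : ∀ x → form x x 𝔽.≈ 𝔽.0#

  open AlternatingForm using (form)

  private
    interchange : ∀ a b d e → (a 𝔽.+ b) 𝔽.+ (d 𝔽.+ e) 𝔽.≈ (a 𝔽.+ d) 𝔽.+ (b 𝔽.+ e)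
    interchange a b d e = begin
      (a 𝔽.+ b) 𝔽.+ (d 𝔽.+ e)  ≈⟨ 𝔽.+-assoc _ _ _ ⟩
      a 𝔽.+ (b 𝔽.+ (d 𝔽.+ e))  ≈⟨ 𝔽.+-congˡ (𝔽.+-assoc _ _ _) ⟨
      a 𝔽.+ ((b 𝔽.+ d) 𝔽.+ e)  ≈⟨ 𝔽.+-congˡ (𝔽.+-congʳ (𝔽.+-comm _ _)) ⟩
      a 𝔽.+ ((d 𝔽.+ b) 𝔽.+ e)  ≈⟨ 𝔽.+-congˡ (𝔽.+-assoc _ _ _) ⟩
      a 𝔽.+ (d 𝔽.+ (b 𝔽.+ e))  ≈⟨ 𝔽.+-assoc _ _ _ ⟨
      (a 𝔽.+ d) 𝔽.+ (b 𝔽.+ e)  ∎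
      where open SetoidReasoning 𝔽.setoid

    *-swap : ∀ k l a → k 𝔽.* (l 𝔽.* a) 𝔽.≈ l 𝔽.* (k 𝔽.* a)
    *-swap k l a = begin
      k 𝔽.* (l 𝔽.* a)  ≈⟨ 𝔽.*-assoc _ _ _ ⟨
      (k 𝔽.* l) 𝔽.* a  ≈⟨ 𝔽.*-congʳ (𝔽.*-comm _ _) ⟩
      (l 𝔽.* k) 𝔽.* a  ≈⟨ 𝔽.*-assoc _ _ _ ⟩
      l 𝔽.* (k 𝔽.* a)  ∎
      where open SetoidReasoning 𝔽.setoid

  module _ {U : VectorSpace 𝔽 m ℓm} where

    0-form : AlternatingForm U
    0-form = record
      { form = λ _ _ → 𝔽.0#
      ; cong = λ _ _ → 𝔽.refl
      ; +-linearˡ = λ _ _ _ → 𝔽.sym (𝔽.+-identityˡ _)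
      ; *-linearˡ = λ _ _ _ → 𝔽.sym (𝔽.zeroʳ _)
      ; +-linearʳ = λ _ _ _ → 𝔽.sym (𝔽.+-identityˡ _)
      ; *-linearʳ = λ _ _ _ → 𝔽.sym (𝔽.zeroʳ _)
      ; alternating = λ _ → 𝔽.refl
      }

    +-form : AlternatingForm U → AlternatingForm U → AlternatingForm U
    +-form f g = record
      { form = λ x y → form f x y 𝔽.+ form g x y
      ; cong = λ x≈ y≈ → 𝔽.+-cong (f.cong x≈ y≈) (g.cong x≈ y≈)
      ; +-linearˡ = λ x x′ y →
          𝔽.trans (𝔽.+-cong (f.+-linearˡ x x′ y) (g.+-linearˡ x x′ y)) (interchange _ _ _ _)
      ; *-linearˡ = λ k x y →
          𝔽.trans (𝔽.+-cong (f.*-linearˡ k x y) (g.*-linearˡ k x y)) (𝔽.sym (𝔽.distribˡ _ _ _))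
      ; +-linearʳ = λ x y y′ →
          𝔽.trans (𝔽.+-cong (f.+-linearʳ x y y′) (g.+-linearʳ x y y′)) (interchange _ _ _ _)
      ; *-linearʳ = λ k x y →
          𝔽.trans (𝔽.+-cong (f.*-linearʳ k x y) (g.*-linearʳ k x y)) (𝔽.sym (𝔽.distribˡ _ _ _))
      ; alternating = λ x →
          𝔽.trans (𝔽.+-cong (f.alternating x) (g.alternating x)) (𝔽.+-identityˡ _)
      }
      where
      module f = AlternatingForm f
      module g = AlternatingForm g

    *-form : 𝔽.Carrier → AlternatingForm U → AlternatingForm U
    *-form l f = record
      { form = λ x y → l 𝔽.* form f x y
      ; cong = λ x≈ y≈ → 𝔽.*-congˡ (f.cong x≈ y≈)
      ; +-linearˡ = λ x x′ y → 𝔽.trans (𝔽.*-congˡ (f.+-linearˡ x x′ y)) (𝔽.distribˡ _ _ _)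
      ; *-linearˡ = λ k x y → 𝔽.trans (𝔽.*-congˡ (f.*-linearˡ k x y)) (*-swap _ _ _)
      ; +-linearʳ = λ x y y′ → 𝔽.trans (𝔽.*-congˡ (f.+-linearʳ x y y′)) (𝔽.distribˡ _ _ _)
      ; *-linearʳ = λ k x y → 𝔽.trans (𝔽.*-congˡ (f.*-linearʳ k x y)) (*-swap _ _ _)
      ; alternating = λ x → 𝔽.trans (𝔽.*-congˡ (f.alternating x)) (𝔽.zeroʳ _)
      }
      where module f = AlternatingForm f

  -- Negation is again scaling by -1.
  Λ : VectorSpace 𝔽 m ℓm → VectorSpace 𝔽 (c ⊔ ℓ ⊔ m ⊔ ℓm) (m ⊔ ℓ)
  Λ U = record
    { Carrierᴹ = AlternatingForm U
    ; _≈ᴹ_ = λ f g → ∀ x y → form f x y 𝔽.≈ form g x y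
    ; _+ᴹ_ = +-form
    ; _*ₗ_ = *-form
    ; _*ᵣ_ = flip *-form
    ; 0ᴹ = 0-form
    ; -ᴹ_ = *-form (𝔽.- 𝔽.1#)
    ; isModule = IsModuleFromLeft.isModule {commutativeRing = 𝔽} record
      { isLeftModule = record
        { isLeftSemimodule = record
          { +ᴹ-isCommutativeMonoid = record
            { isMonoid = record
              { isSemigroup = record
                { isMagma = record
                  { isEquivalence = record
                    { refl = λ _ _ → 𝔽.refl
                    ; sym = λ p x y → 𝔽.sym (p x y)
                    ; trans = λ p q x y → 𝔽.trans (p x y) (q x y)
                    }
                  ; ∙-cong = λ p q x y → 𝔽.+-cong (p x y) (q x y)
                  }
                ; assoc = λ _ _ _ _ _ → 𝔽.+-assoc _ _ _
                }
              ; identity = (λ _ _ _ → 𝔽.+-identityˡ _) , (λ _ _ _ → 𝔽.+-identityʳ _)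
              }
            ; comm = λ _ _ _ _ → 𝔽.+-comm _ _
            }
          ; isPreleftSemimodule = record
            { *ₗ-cong = λ k≈ p x y → 𝔽.*-cong k≈ (p x y)
            ; *ₗ-zeroˡ = λ _ _ _ → 𝔽.zeroˡ _
            ; *ₗ-distribʳ = λ _ _ _ _ _ → 𝔽.distribʳ _ _ _
            ; *ₗ-identityˡ = λ _ _ _ → 𝔽.*-identityˡ _
            ; *ₗ-assoc = λ _ _ _ _ _ → 𝔽.*-assoc _ _ _
            ; *ₗ-zeroʳ = λ _ _ _ → 𝔽.zeroʳ _
            ; *ₗ-distribˡ = λ _ _ _ _ _ → 𝔽.distribˡ _ _ _
            }
          }
        ; -ᴹ‿cong = λ p x y → 𝔽.*-congˡ (p x y)
        ; -ᴹ‿inverse = (λ f x y → inverseˡ (form f x y))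
                     , (λ f x y → 𝔽.trans (𝔽.+-comm _ _) (inverseˡ (form f x y)))
        }
      }
    }
    where
    open SetoidReasoning 𝔽.setoid

    inverseˡ : ∀ a → (𝔽.- 𝔽.1#) 𝔽.* a 𝔽.+ a 𝔽.≈ 𝔽.0#
    inverseˡ a = begin
      (𝔽.- 𝔽.1#) 𝔽.* a 𝔽.+ a            ≈⟨ 𝔽.+-congˡ (𝔽.*-identityˡ a) ⟨
      (𝔽.- 𝔽.1#) 𝔽.* a 𝔽.+ 𝔽.1# 𝔽.* a   ≈⟨ 𝔽.distribʳ a _ _ ⟨
      (𝔽.- 𝔽.1# 𝔽.+ 𝔽.1#) 𝔽.* a         ≈⟨ 𝔽.*-congʳ (𝔽.-‿inverseˡ 𝔽.1#) ⟩
      𝔽.0# 𝔽.* a                        ≈⟨ 𝔽.zeroˡ a ⟩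
      𝔽.0#                              ∎

  module _ {U : VectorSpace 𝔽 m ℓm} where

    restrictForm : AlternatingForm U → (W : Subspace U p) → AlternatingForm ⟦ W ⟧
    restrictForm f W = record
      { form = λ x y → form f (proj₁ x) (proj₁ y)
      ; cong = f.cong
      ; +-linearˡ = λ _ _ _ → f.+-linearˡ _ _ _
      ; *-linearˡ = λ _ _ _ → f.*-linearˡ _ _ _
      ; +-linearʳ = λ _ _ _ → f.+-linearʳ _ _ _
      ; *-linearʳ = λ _ _ _ → f.*-linearʳ _ _ _
      ; alternating = λ _ → f.alternating _
      }
      where module f = AlternatingForm f

    _∣_ : Subspace (Λ U) q → (W : Subspace U p) →
          Subspace (Λ ⟦ W ⟧) (c ⊔ ℓ ⊔ m ⊔ ℓm ⊔ p ⊔ q)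
    𝒜 ∣ W = record
      { Member = λ g → ∃[ f ] Member 𝒜 f × restrictForm f W ≈ᴹ g
      ; resp = λ g≈h (f , f∈ , f≈g) → f , f∈ , λ x y → 𝔽.trans (f≈g x y) (g≈h x y)
      ; 0-mem = 0-form , 0-mem , λ _ _ → 𝔽.refl
      ; +-mem = λ (f , f∈ , f≈) (g , g∈ , g≈) →
          +-form f g , +-mem f∈ g∈ , λ x y → 𝔽.+-cong (f≈ x y) (g≈ x y)
      ; *-mem = λ k (f , f∈ , f≈) →
          *-form k f , *-mem k f∈ , λ x y → 𝔽.*-congˡ (f≈ x y)
      }
      where
      open Subspace 𝒜
      open Module (Λ ⟦ W ⟧) using (_≈ᴹ_)

{-# OPTIONS --safe #-}

-- Call v thin if few linear functionals have to vanish at u to ensure f(v,u) = 0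
-- for all f ∈ 𝒜.  Inside the common kernel of fewer than n functionals, extend
-- greedily a family w₁,…,w_k on which 𝒜 realises all alternating Gram matrices.
-- An extension by u needs the map f ↦ (f(w_i,u))_i, on the forms of 𝒜 vanishing
-- on the family, to be onto F^k.  Such a u is a sum of k vectors found by Gaussian
-- elimination: if h(w₁,x) ≠ 0 for an admissible form h and vector x, clear the other
-- h(w_i,x) by multiples of w₁, and require of all later vectors y and forms f that
-- h(w_i,y) = 0 and f(w_i,x) = 0, so that no cross terms arise.  The elimination is
-- stuck only if the current w₁ is thin.  So either the family reaches size t, or
-- there is a thin vector; in the latter case restrict to the vectors orthogonal to
-- it, and to the kernel of one functional nonzero at it, and repeat.  Each thin
-- vector costs at most 1 + 2t(t − 1) ≤ t⁴ functionals, so s t⁴ ≤ n leaves room for s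
-- of them.
module Submission where

open import Algebra.Bundles using (CommutativeRing)
open import Algebra.Module.Bundles using (Module)
open import Axiom.ExcludedMiddle using (ExcludedMiddle)
open import Data.Fin.Base as Fin using (Fin; zero; suc)
open import Data.Fin.Properties using (<-cmp)
open import Data.List.Base using (List; []; _∷_; _++_; length; map; tabulate; cartesianProduct)
open import Data.List.Membership.Propositional.Properties
  using (∈-cartesianProduct⁺; ∈-tabulate⁺)
open import Data.List.Properties using (length-++; length-map; length-tabulate)
open import Data.List.Relation.Unary.All as All using (All; []; _∷_)
open import Data.List.Relation.Unary.All.Properties
  using (++⁻ˡ; ++⁻ʳ; tabulate⁻)
open import Data.Nat.Base as ℕ using (ℕ; zero; suc; _≤_; _<_; _*_; _^_; z≤n; s≤s)
open import Data.Product.Base using (Σ-syntax; ∃-syntax; _×_; _,_; proj₁; proj₂)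
open import Data.Sum.Base using (_⊎_; inj₁; inj₂)
open import Data.Vec.Functional as Vector using (Vector)
open import Function.Base using (_∘_; case_of_)
open import Level using (Level; _⊔_; Lift; lift; lower)
open import Relation.Binary.Definitions using (Decidable; tri<; tri≈; tri>)
open import Relation.Binary.PropositionalEquality.Core as ≡ using (_≡_)
open import Relation.Nullary.Decidable using (yes; no; map′; decidable-stable)
open import Relation.Nullary.Negation using (¬_)
import Algebra.Properties.CommutativeMonoid.Sum as Sum
import Algebra.Properties.Ring as RingProperties
import Data.Nat.Properties as ℕ
import Data.Nat.Tactic.RingSolver as ℕSolver
import Relation.Binary.Reasoning.Setoid as SetoidReasoning
open import Defs
open AlternatingForm using (form)

private
  variable
    c ℓ m ℓm a p : Level
    n : ℕ

-- Universe levels and lengths of lists.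

lowerExcludedMiddle : ∀ a b → ExcludedMiddle (a ⊔ b) → ExcludedMiddle a
lowerExcludedMiddle a b em {P} = map′ lower lift (em {Lift b P})

length-cartesianProduct : ∀ {A : Set a} {B : Set p} (xs : List A) (ys : List B) →
  length (cartesianProduct xs ys) ≡ length xs * length ys
length-cartesianProduct []       ys = ≡.refl
length-cartesianProduct (x ∷ xs) ys = ≡.trans
  (length-++ (map (x ,_) ys))
  (≡.cong₂ ℕ._+_ (length-map (x ,_) ys) (length-cartesianProduct xs ys))

-- Antisymmetry and scalar equations over a field.

module _ {𝔽 : CommutativeRing c ℓ} where

  open CommutativeRing 𝔽 hiding (zero) renaming (Carrier to F; _*_ to _·_)
  open RingProperties ring

  antisymmetric : {M : VectorSpace 𝔽 m ℓm} (f : AlternatingForm M) →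
    ∀ x y → form f x y ≈ - form f y x
  antisymmetric {M = M} f x y = +-inverseˡ-unique _ _ (begin
    form f x y + form f y x
      ≈⟨ +-cong (+-identityˡ _) (+-identityʳ _) ⟨
    (0# + form f x y) + (form f y x + 0#)
      ≈⟨ +-cong (+-congʳ (f.alternating x)) (+-congˡ (f.alternating y)) ⟨
    (form f x x + form f x y) + (form f y x + form f y y)
      ≈⟨ +-cong (f.+-linearʳ x x y) (f.+-linearʳ y x y) ⟨
    form f x (x +ᴹ y) + form f y (x +ᴹ y)
      ≈⟨ f.+-linearˡ x y (x +ᴹ y) ⟨
    form f (x +ᴹ y) (x +ᴹ y)
      ≈⟨ f.alternating (x +ᴹ y) ⟩
    0# ∎)
    where
    module f = AlternatingForm f
    open Module M
    open SetoidReasoning setoid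

  -- Supplies the multiple `k` of a form or of a pivot vector whose addition turns the value `b`
  -- into `d`.
  affine-root : IsField 𝔽 → ∀ {a} → ¬ a ≈ 0# → ∀ b d → ∃[ k ] k · a + b ≈ d
  affine-root isField {a} a≉0 b d = (d - b) · a⁻¹ , (begin
    (d - b) · a⁻¹ · a + b   ≈⟨ +-congʳ (*-assoc _ _ _) ⟩
    (d - b) · (a⁻¹ · a) + b ≈⟨ +-congʳ (*-congˡ (proj₁ (proj₂ inv))) ⟩
    (d - b) · 1# + b        ≈⟨ +-congʳ (*-identityʳ _) ⟩
    d - b + b               ≈⟨ //-rightDividesˡ b d ⟩
    d                       ∎)
    where
    open SetoidReasoning setoid
    inv = IsField.invertible isField a a≉0
    a⁻¹ = proj₁ inv

  x*y≈0⇒x≈0 : IsField 𝔽 → ∀ {x y} → ¬ y ≈ 0# → x · y ≈ 0# → x ≈ 0#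
  x*y≈0⇒x≈0 isField {x} {y} y≉0 xy≈0 = begin
    x             ≈⟨ *-identityʳ x ⟨
    x · 1#        ≈⟨ *-congˡ (proj₂ (proj₂ inv)) ⟨
    x · (y · y⁻¹) ≈⟨ *-assoc _ _ _ ⟨
    x · y · y⁻¹   ≈⟨ *-congʳ xy≈0 ⟩
    0# · y⁻¹      ≈⟨ zeroˡ _ ⟩
    0#            ∎
    where
    open SetoidReasoning setoid
    inv = IsField.invertible isField y y≉0
    y⁻¹ = proj₁ inv

  δ : Fin n → Vector F n
  δ zero    = 1# Vector.∷ λ _ → 0#
  δ (suc i) = 0# Vector.∷ δ i

  δ-diagonal : (i : Fin n) → δ i i ≡ 1#
  δ-diagonal zero    = ≡.refl
  δ-diagonal (suc i) = δ-diagonal i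

  δ-upper : {i j : Fin n} → i Fin.< j → δ i j ≡ 0#
  δ-upper {i = zero}  {suc j} _         = ≡.refl
  δ-upper {i = suc i} {suc j} (s≤s i<j) = δ-upper i<j

  -- Linear functionals.

  record LinearFunctional (M : VectorSpace 𝔽 m ℓm) : Set (c ⊔ ℓ ⊔ m ⊔ ℓm) where
    open Module M
    field
      apply  : Carrierᴹ → F
      cong   : ∀ {x y} → x ≈ᴹ y → apply x ≈ apply y
      +-homo : ∀ x y → apply (x +ᴹ y) ≈ apply x + apply y
      *-homo : ∀ k x → apply (k *ₗ x) ≈ k · apply x

    0-homo : apply 0ᴹ ≈ 0#
    0-homo = trans (cong (≈ᴹ-sym (*ₗ-zeroˡ 0ᴹ))) (trans (*-homo 0# 0ᴹ) (zeroˡ _))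

    +*-homo : ∀ x k y → apply (x +ᴹ k *ₗ y) ≈ apply x + k · apply y
    +*-homo x k y = trans (+-homo x (k *ₗ y)) (+-congˡ (*-homo k y))

    +-zero : ∀ {x y} → apply x ≈ 0# → apply y ≈ 0# → apply (x +ᴹ y) ≈ 0#
    +-zero x≈0 y≈0 = trans (+-homo _ _) (trans (+-cong x≈0 y≈0) (+-identityˡ 0#))

    *-zero : ∀ k {x} → apply x ≈ 0# → apply (k *ₗ x) ≈ 0#
    *-zero k x≈0 = trans (*-homo k _) (trans (*-congˡ x≈0) (zeroʳ k))

  open LinearFunctional using (apply)

  leftFunctional : {M : VectorSpace 𝔽 m ℓm} → AlternatingForm M →
    Module.Carrierᴹ M → LinearFunctional M
  leftFunctional {M = M} f y = record
    { apply  = λ x → form f x y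
    ; cong   = λ x≈ → f.cong x≈ ≈ᴹ-refl
    ; +-homo = λ x x′ → f.+-linearˡ x x′ y
    ; *-homo = λ k x → f.*-linearˡ k x y
    }
    where
    module f = AlternatingForm f
    open Module M

  rightFunctional : {M : VectorSpace 𝔽 m ℓm} → AlternatingForm M →
    Module.Carrierᴹ M → LinearFunctional M
  rightFunctional {M = M} f x = record
    { apply  = form f x
    ; cong   = f.cong ≈ᴹ-refl
    ; +-homo = f.+-linearʳ x
    ; *-homo = λ k y → f.*-linearʳ k x y
    }
    where
    module f = AlternatingForm f
    open Module M

  -- Linear combinations, bases and coordinates.

  module _ (M : VectorSpace 𝔽 m ℓm) where

    open Module M
    open Sum +ᴹ-commutativeMonoid using (sum-cong-≋; ∑-distrib-+)

    private
      lc : Vector F n → Vector Carrierᴹ n → Carrierᴹ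
      lc = linearCombination M

    lc-+ : ∀ (a b : Vector F n) v → lc (λ i → a i + b i) v ≈ᴹ lc a v +ᴹ lc b v
    lc-+ a b v = ≈ᴹ-trans (sum-cong-≋ λ i → *ₗ-distribʳ (v i) (a i) (b i))
                          (∑-distrib-+ (λ i → a i *ₗ v i) (λ i → b i *ₗ v i))

    lc-* : ∀ k (a : Vector F n) v → lc (λ i → k · a i) v ≈ᴹ k *ₗ lc a v
    lc-* {n = zero}  k a v = ≈ᴹ-sym (*ₗ-zeroʳ k)
    lc-* {n = suc n} k a v = ≈ᴹ-trans
      (+ᴹ-cong (*ₗ-assoc k _ _) (lc-* k (a ∘ suc) (v ∘ suc)))
      (≈ᴹ-sym (*ₗ-distribˡ k _ _))

    lc-zero : ∀ {a : Vector F n} → (∀ i → a i ≈ 0#) → ∀ v → lc a v ≈ᴹ 0ᴹ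
    lc-zero {n = zero}  a≈0 v = ≈ᴹ-refl
    lc-zero {n = suc n} a≈0 v = ≈ᴹ-trans
      (+ᴹ-cong (≈ᴹ-trans (*ₗ-cong (a≈0 zero) ≈ᴹ-refl) (*ₗ-zeroˡ _))
               (lc-zero (a≈0 ∘ suc) (v ∘ suc)))
      (+ᴹ-identityˡ 0ᴹ)

    lc-δ : ∀ (i : Fin n) v → lc (δ i) v ≈ᴹ v i
    lc-δ zero    v = ≈ᴹ-trans
      (+ᴹ-cong (*ₗ-identityˡ _) (lc-zero (λ _ → refl) (v ∘ suc))) (+ᴹ-identityʳ _)
    lc-δ (suc i) v = ≈ᴹ-trans (+ᴹ-cong (*ₗ-zeroˡ _) (lc-δ i (v ∘ suc))) (+ᴹ-identityˡ _)

    lc-injective : ∀ {v : Vector Carrierᴹ n} → LinearlyIndependent M v →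
      ∀ {a b} → lc a v ≈ᴹ lc b v → ∀ i → a i ≈ b i
    lc-injective {v = v} indep {a} {b} a≈b i =
      x∙y⁻¹≈ε⇒x≈y _ _ (trans (+-congˡ (sym (-1*x≈-x (b i))))
        (indep (λ i → a i + - 1# · b i) (begin
          lc (λ i → a i + - 1# · b i) v          ≈⟨ lc-+ a (λ i → - 1# · b i) v ⟩
          lc a v +ᴹ lc (λ i → - 1# · b i) v      ≈⟨ +ᴹ-cong a≈b (lc-* (- 1#) b v) ⟩
          lc b v +ᴹ - 1# *ₗ lc b v               ≈⟨ +ᴹ-cong (*ₗ-identityˡ _) ≈ᴹ-refl ⟨
          1# *ₗ lc b v +ᴹ - 1# *ₗ lc b v         ≈⟨ *ₗ-distribʳ _ _ _ ⟨
          (1# - 1#) *ₗ lc b v                    ≈⟨ *ₗ-cong (-‿inverseʳ 1#) ≈ᴹ-refl ⟩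
          0# *ₗ lc b v                           ≈⟨ *ₗ-zeroˡ _ ⟩
          0ᴹ                                     ∎) i))
      where open SetoidReasoning ≈ᴹ-setoid

    functional-ext : ∀ {v : Vector Carrierᴹ n} → Spanning M v →
      (φ ψ : LinearFunctional M) → (∀ i → apply φ (v i) ≈ apply ψ (v i)) →
      ∀ x → apply φ x ≈ apply ψ x
    functional-ext {v = v} spanning φ ψ φ≈ψ x = let (a , x≈) = spanning x in
      trans (φ.cong x≈) (trans (on-lc a v φ≈ψ) (sym (ψ.cong x≈)))
      where
      module φ = LinearFunctional φ
      module ψ = LinearFunctional ψ
      on-lc : ∀ {n} (a : Vector F n) v → (∀ i → φ.apply (v i) ≈ ψ.apply (v i)) →
        φ.apply (lc a v) ≈ ψ.apply (lc a v)
      on-lc {zero}  a v eq = trans φ.0-homo (sym ψ.0-homo)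
      on-lc {suc n} a v eq = trans (φ.+-homo _ _) (trans
        (+-cong (trans (φ.*-homo _ _) (trans (*-congˡ (eq zero)) (sym (ψ.*-homo _ _))))
                (on-lc (a ∘ suc) (v ∘ suc) (eq ∘ suc)))
        (sym (ψ.+-homo _ _)))

    -- The diagonal vanishes and antisymmetry supplies one half of the Gram matrix from the other,
    -- so one triangle determines the form. The later index comes first, as in `prescribe` and
    -- `isotropic`.
    form-ext : ∀ {v : Vector Carrierᴹ n} → Spanning M v → (f g : AlternatingForm M) →
      (∀ i j → i Fin.< j → form f (v j) (v i) ≈ form g (v j) (v i)) →
      ∀ x y → form f x y ≈ form g x y
    form-ext {n = n} {v = v} spanning f g f≈g x y =
      functional-ext spanning (rightFunctional f x) (rightFunctional g x)
        (λ j → functional-ext spanning (leftFunctional f (v j)) (leftFunctional g (v j))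
          (λ i → on-basis i j) x) y
      where
      on-basis : ∀ i j → form f (v i) (v j) ≈ form g (v i) (v j)
      on-basis i j with <-cmp i j
      ... | tri< i<j _ _    = trans (antisymmetric f _ _)
                                (trans (-‿cong (f≈g i j i<j)) (sym (antisymmetric g _ _)))
      ... | tri≈ _ ≡.refl _ = trans (AlternatingForm.alternating f _)
                                (sym (AlternatingForm.alternating g _))
      ... | tri> _ _ j<i    = f≈g j i j<i

    module _ (dimension : HasDimension M n) where

      private
        basis    = proj₁ dimension
        indep    = proj₁ (proj₂ dimension)
        spanning = proj₂ (proj₂ dimension)

        coords : Carrierᴹ → Vector F n
        coords x = proj₁ (spanning x)

        lc-coords : ∀ x → x ≈ᴹ lc (coords x) basis
        lc-coords x = proj₂ (spanning x)

        coords-unique : ∀ {x} a → x ≈ᴹ lc a basis → ∀ i → coords x i ≈ a i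
        coords-unique {x} a x≈ = lc-injective indep (≈ᴹ-trans (≈ᴹ-sym (lc-coords x)) x≈)

      -- The coefficients are those chosen by the spanning property; independence makes the choice
      -- unique, hence linear and compatible with `≈ᴹ`.
      coordinate : Fin n → LinearFunctional M
      coordinate i = record
        { apply  = λ x → coords x i
        ; cong   = λ {x} {y} x≈y → coords-unique (coords y) (≈ᴹ-trans x≈y (lc-coords y)) i
        ; +-homo = λ x y → coords-unique (λ i → coords x i + coords y i)
            (≈ᴹ-trans (+ᴹ-cong (lc-coords x) (lc-coords y)) (≈ᴹ-sym (lc-+ _ _ basis))) i
        ; *-homo = λ k x → coords-unique (λ i → k · coords x i)
            (≈ᴹ-trans (*ₗ-cong refl (lc-coords x)) (≈ᴹ-sym (lc-* k _ basis))) i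
        }

      coordinate-basis : ∀ i j → apply (coordinate j) (basis i) ≈ δ i j
      coordinate-basis i j = coords-unique (δ i) (≈ᴹ-sym (lc-δ i basis)) j

  -- Spans, kernels and triangular systems.

  module _ {M : VectorSpace 𝔽 m ℓm} where

    open Module M

    span : Vector Carrierᴹ n → Subspace M (c ⊔ ℓm)
    span v = record
      { Member = λ x → ∃[ a ] x ≈ᴹ linearCombination M a v
      ; resp   = λ x≈y (a , x≈) → a , ≈ᴹ-trans (≈ᴹ-sym x≈y) x≈
      ; 0-mem  = (λ _ → 0#) , ≈ᴹ-sym (lc-zero M (λ _ → refl) v)
      ; +-mem  = λ (a , x≈) (b , y≈) → (λ i → a i + b i) ,
                   ≈ᴹ-trans (+ᴹ-cong x≈ y≈) (≈ᴹ-sym (lc-+ M a b v))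
      ; *-mem  = λ k (a , x≈) → (λ i → k · a i) ,
                   ≈ᴹ-trans (*ₗ-cong refl x≈) (≈ᴹ-sym (lc-* M k a v))
      }

    lc-⟦⟧ : ∀ {W : Subspace M p} a (v : Vector (Module.Carrierᴹ ⟦ W ⟧) n) →
      proj₁ (linearCombination ⟦ W ⟧ a v) ≈ᴹ linearCombination M a (proj₁ ∘ v)
    lc-⟦⟧ {n = zero}  a v = ≈ᴹ-refl
    lc-⟦⟧ {n = suc n} {W = W} a v = +ᴹ-cong ≈ᴹ-refl (lc-⟦⟧ {W = W} (a ∘ suc) (v ∘ suc))

    span-dimension : ∀ {v : Vector Carrierᴹ n} → LinearlyIndependent M v →
      HasDimension ⟦ span v ⟧ n
    span-dimension {v = v} indep = basis
      , (λ a a≈0 → indep a (≈ᴹ-trans (≈ᴹ-sym (lc-⟦⟧ {W = span v} a basis)) a≈0))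
      , (λ (x , a , x≈) → a , ≈ᴹ-trans x≈ (≈ᴹ-sym (lc-⟦⟧ {W = span v} a basis)))
      where
      basis : Vector (Module.Carrierᴹ ⟦ span v ⟧) _
      basis i = v i , δ i , ≈ᴹ-sym (lc-δ M i v)

    _∈ker_ : Carrierᴹ → List (LinearFunctional M) → Set (c ⊔ ℓ ⊔ m ⊔ ℓm)
    x ∈ker Φ = All (λ φ → apply φ x ≈ 0#) Φ

    ker-0 : ∀ Φ → 0ᴹ ∈ker Φ
    ker-0 Φ = All.universal LinearFunctional.0-homo Φ

    ker-+ : ∀ {Φ x y} → x ∈ker Φ → y ∈ker Φ → (x +ᴹ y) ∈ker Φ
    ker-+ x∈ y∈ = All.zipWith (λ {φ} (x≈0 , y≈0) → LinearFunctional.+-zero φ x≈0 y≈0) (x∈ , y∈)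

    ker-* : ∀ {Φ} k {x} → x ∈ker Φ → (k *ₗ x) ∈ker Φ
    ker-* k = All.map (λ {φ} → LinearFunctional.*-zero φ k)

    -- Unlike full duality, this survives prepending a vector on which the old
    -- functionals vanish, without correcting the new functional.
    record Triangular (v : Vector Carrierᴹ n) (p : Vector (LinearFunctional M) n) : Set ℓ where
      field
        diagonal : ∀ i → ¬ apply (p i) (v i) ≈ 0#
        upper    : ∀ {i j} → i Fin.< j → apply (p j) (v i) ≈ 0#

    open Triangular

    triangular-[] : ∀ {v : Vector Carrierᴹ 0} {p} → Triangular v p
    triangular-[] = record { diagonal = λ () ; upper = λ { {()} } }

    triangular-∷ : ∀ {x φ} {v : Vector Carrierᴹ n} {p} → ¬ apply φ x ≈ 0# →
      (∀ i → apply (p i) x ≈ 0#) → Triangular v p →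
      Triangular (x Vector.∷ v) (φ Vector.∷ p)
    triangular-∷ φx≉0 px≈0 tri = record
      { diagonal = λ { zero → φx≉0 ; (suc i) → diagonal tri i }
      ; upper    = λ { {zero} {suc j} _ → px≈0 j ; {suc i} {suc j} (s≤s i<j) → upper tri i<j }
      }

    triangular-tail : ∀ {v : Vector Carrierᴹ (suc n)} {p} → Triangular v p →
      Triangular (v ∘ suc) (p ∘ suc)
    triangular-tail tri = record
      { diagonal = diagonal tri ∘ suc ; upper = λ i<j → upper tri (s≤s i<j) }

    pivot : Vector Carrierᴹ (suc n) → Vector F n → Vector Carrierᴹ n
    pivot v γ i = v (suc i) +ᴹ γ i *ₗ v zero

    -- The remaining functionals vanish at `v zero`, so adding multiples of it changes none of their
    -- values.
    triangular-pivot : ∀ {v : Vector Carrierᴹ (suc n)} {p} γ → Triangular v p →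
      Triangular (pivot v γ) (p ∘ suc)
    triangular-pivot {v = v} {p} γ tri = record
      { diagonal = λ i eq → diagonal tri (suc i)
          (trans (sym (trans (pivot-homo i i) (+-identityʳ _))) eq)
      ; upper    = λ {i} {j} i<j →
          trans (pivot-homo i j) (trans (+-identityʳ _) (upper tri (s≤s i<j)))
      }
      where
      pivot-homo : ∀ i j → apply (p (suc j)) (pivot v γ i) ≈ apply (p (suc j)) (v (suc i)) + 0#
      pivot-homo i j = trans (LinearFunctional.+-homo (p (suc j)) _ _)
        (+-congˡ (LinearFunctional.*-zero (p (suc j)) (γ i) (upper tri (s≤s z≤n))))

    pivot-∈ker : ∀ {v : Vector Carrierᴹ (suc n)} {Φ} γ → (∀ i → v i ∈ker Φ) →
      ∀ i → pivot v γ i ∈ker Φ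
    pivot-∈ker γ v∈ i = ker-+ (v∈ (suc i)) (ker-* (γ i) (v∈ zero))

    module _ (isField : IsField 𝔽) where

      annihilating-pivot : (v : Vector Carrierᴹ (suc n)) (φ : LinearFunctional M) →
        ¬ apply φ (v zero) ≈ 0# → ∃[ γ ] (∀ i → apply φ (pivot v γ i) ≈ 0#)
      annihilating-pivot v φ φv₀≉0 = (λ i → proj₁ (root i)) , λ i →
        trans (LinearFunctional.+*-homo φ _ _ _) (trans (+-comm _ _) (proj₂ (root i)))
        where
        root : ∀ i → ∃[ k ] k · apply φ (v zero) + apply φ (v (suc i)) ≈ 0#
        root i = affine-root isField φv₀≉0 _ 0#

      triangular⇒independent : ∀ {v : Vector Carrierᴹ n} {p} → Triangular v p →
        LinearlyIndependent M v
      triangular⇒independent {p = p} tri a eq =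
        shifted tri a 0ᴹ (λ i → LinearFunctional.0-homo (p i)) (≈ᴹ-trans (+ᴹ-identityˡ _) eq)
        where
        -- The induction carries a vector `z` killed by all functionals. The head term can move into
        -- `z`, since every later functional kills `v zero`; once the tail coefficients vanish,
        -- `p zero` sees only the head term.
        shifted : ∀ {n} {v : Vector Carrierᴹ n} {p} → Triangular v p →
          ∀ a z → (∀ i → apply (p i) z ≈ 0#) → z +ᴹ linearCombination M a v ≈ᴹ 0ᴹ →
          ∀ i → a i ≈ 0#
        shifted {suc n} {v} {p} tri a z pz≈0 eq = λ { zero → a₀≈0 ; (suc i) → tail≈0 i }
          where
          open SetoidReasoning setoid
          module p₀ = LinearFunctional (p zero)
          tail = linearCombination M (a ∘ suc) (v ∘ suc)

          tail≈0 : ∀ i → a (suc i) ≈ 0#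
          tail≈0 = shifted (triangular-tail tri) (a ∘ suc) (z +ᴹ a zero *ₗ v zero)
            (λ i → LinearFunctional.+-zero (p (suc i)) (pz≈0 (suc i))
                     (LinearFunctional.*-zero (p (suc i)) _ (upper tri (s≤s z≤n))))
            (≈ᴹ-trans (+ᴹ-assoc _ _ _) eq)

          a₀≈0 : a zero ≈ 0#
          a₀≈0 = x*y≈0⇒x≈0 isField (diagonal tri zero) (begin
            a zero · p₀.apply (v zero)
              ≈⟨ p₀.*-homo _ _ ⟨
            p₀.apply (a zero *ₗ v zero)
              ≈⟨ +-identityˡ _ ⟨
            0# + p₀.apply (a zero *ₗ v zero)
              ≈⟨ +-congʳ (pz≈0 zero) ⟨
            p₀.apply z + p₀.apply (a zero *ₗ v zero)
              ≈⟨ p₀.+-homo _ _ ⟨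
            p₀.apply (z +ᴹ a zero *ₗ v zero)
              ≈⟨ p₀.cong (+ᴹ-cong ≈ᴹ-refl (+ᴹ-identityʳ _)) ⟨
            p₀.apply (z +ᴹ (a zero *ₗ v zero +ᴹ 0ᴹ))
              ≈⟨ p₀.cong (+ᴹ-cong ≈ᴹ-refl (+ᴹ-cong ≈ᴹ-refl (lc-zero M tail≈0 (v ∘ suc)))) ⟨
            p₀.apply (z +ᴹ (a zero *ₗ v zero +ᴹ tail))
              ≈⟨ p₀.cong eq ⟩
            p₀.apply 0ᴹ
              ≈⟨ p₀.0-homo ⟩
            0# ∎)

      -- Gaussian elimination and common zeros of functionals.

      module _ (_≟_ : Decidable _≈_) where

        -- Functionals are compared through their common zeros: `functionals⊆` is what allows a kept
        -- vector to be put back in front of the result.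
        record Elimination (φ : LinearFunctional M) (Φ : List (LinearFunctional M))
                           (p : Vector (LinearFunctional M) (suc n)) :
                           Set (c ⊔ ℓ ⊔ m ⊔ ℓm) where
          field
            vectors      : Vector Carrierᴹ n
            functionals  : Vector (LinearFunctional M) n
            triangular   : Triangular vectors functionals
            vectors∈ker  : ∀ i → vectors i ∈ker (φ ∷ Φ)
            functionals⊆ : ∀ {x} → (∀ i → apply (p i) x ≈ 0#) →
                           ∀ i → apply (functionals i) x ≈ 0#

        -- The first vector at which `φ` does not vanish becomes the pivot and is dropped; the
        -- vectors before it are kept unchanged.
        eliminate : ∀ φ Φ {v : Vector Carrierᴹ (suc n)} {p} → Triangular v p →
          (∀ i → v i ∈ker Φ) → Elimination φ Φ p
        eliminate {n} φ Φ {v} {p} tri v∈ with apply φ (v zero) ≟ 0#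
        ... | no φv₀≉0 = let (γ , φγ≈0) = annihilating-pivot v φ φv₀≉0 in record
          { vectors      = pivot v γ
          ; functionals  = p ∘ suc
          ; triangular   = triangular-pivot γ tri
          ; vectors∈ker  = λ i → φγ≈0 i ∷ pivot-∈ker γ v∈ i
          ; functionals⊆ = λ px≈0 i → px≈0 (suc i)
          }
        -- The result must have size zero, so the last vector is discarded although `φ` vanishes at
        -- it.
        eliminate {zero} φ Φ {v} {p} tri v∈ | yes φv₀≈0 = record
          { vectors      = λ ()
          ; functionals  = λ ()
          ; triangular   = triangular-[]
          ; vectors∈ker  = λ ()
          ; functionals⊆ = λ _ ()
          }
        eliminate {suc n} φ Φ {v} {p} tri v∈ | yes φv₀≈0 = record
          { vectors      = v zero Vector.∷ E.vectors
          ; functionals  = p zero Vector.∷ E.functionals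
          ; triangular   = triangular-∷ (diagonal tri zero)
              (E.functionals⊆ λ i → upper tri (s≤s z≤n)) E.triangular
          ; vectors∈ker  = λ { zero → φv₀≈0 ∷ v∈ zero ; (suc i) → E.vectors∈ker i }
          ; functionals⊆ = λ { px≈0 zero → px≈0 zero
                             ; px≈0 (suc i) → E.functionals⊆ (px≈0 ∘ suc) i }
          }
          where
          module E = Elimination (eliminate φ Φ (triangular-tail tri) (v∈ ∘ suc))

        -- Each functional of `Ψ` costs one vector, so at least one vector remains, and its
        -- triangular partner certifies that it is nonzero. `Φ` accumulates the functionals already
        -- imposed.
        common-zero : ∀ Ψ Φ {v : Vector Carrierᴹ n} {p} → Triangular v p →
          (∀ i → v i ∈ker Φ) → length Ψ < n →
          ∃[ x ] Σ[ φ ∈ LinearFunctional M ] ¬ apply φ x ≈ 0# × x ∈ker Ψ × x ∈ker Φ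
        common-zero []      Φ {v} {p} tri v∈ (s≤s _) =
          v zero , p zero , diagonal tri zero , [] , v∈ zero
        common-zero (ψ ∷ Ψ) Φ tri v∈ (s≤s Ψ<n) =
          case common-zero Ψ (ψ ∷ Φ) E.triangular E.vectors∈ker Ψ<n of λ where
            (x , φ , φx≉0 , x∈Ψ , ψx≈0 ∷ x∈Φ) → x , φ , φx≉0 , ψx≈0 ∷ x∈Ψ , x∈Φ
          where
          module E = Elimination (eliminate ψ Φ tri v∈)

      coordinates-triangular : (dimension : HasDimension M n) →
        Triangular (proj₁ dimension) (coordinate M dimension)
      coordinates-triangular dimension = record
        { diagonal = λ i eq → IsField.1≉0 isField
            (trans (reflexive (≡.sym (δ-diagonal i)))
              (trans (sym (coordinate-basis M dimension i i)) eq))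
        ; upper    = λ {i} {j} i<j →
            trans (coordinate-basis M dimension i j) (reflexive (δ-upper i<j))
        }

  -- Thin vectors and prescribable families.

  module _ {U : VectorSpace 𝔽 m ℓm} where

    open Module U
    open Triangular

    Vanishes : AlternatingForm U → List (Carrierᴹ × Carrierᴹ) → Set (ℓ ⊔ m)
    Vanishes f ρ = All (λ (x , y) → form f x y ≈ 0#) ρ

    vanishingAt : Subspace (Λ U) a → Carrierᴹ → Carrierᴹ → Subspace (Λ U) (a ⊔ ℓ)
    vanishingAt 𝒜 x y = record
      { Member = λ f → Member 𝒜 f × form f x y ≈ 0#
      ; resp   = λ f≈g (f∈ , fxy≈0) → 𝒜.resp f≈g f∈ , trans (sym (f≈g x y)) fxy≈0
      ; 0-mem  = 𝒜.0-mem , refl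
      ; +-mem  = λ (f∈ , fxy≈0) (g∈ , gxy≈0) →
                   𝒜.+-mem f∈ g∈ , trans (+-cong fxy≈0 gxy≈0) (+-identityˡ 0#)
      ; *-mem  = λ k (f∈ , fxy≈0) →
                   𝒜.*-mem k f∈ , trans (*-congˡ fxy≈0) (zeroʳ k)
      }
      where
      module 𝒜 = Subspace 𝒜

    -- `witness` certifies that the vector is nonzero; added to the constraints later, it also keeps
    -- subsequent vectors independent of this one.
    record ThinVector (𝒜 : Subspace (Λ U) a) (Φ : List (LinearFunctional U)) (r : ℕ) :
                      Set (c ⊔ ℓ ⊔ m ⊔ ℓm ⊔ a) where
      field
        vector      : Carrierᴹ
        vector∈ker  : vector ∈ker Φ
        witness     : LinearFunctional U
        nonzero     : ¬ apply witness vector ≈ 0#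
        constraints : List (LinearFunctional U)
        length≤     : length constraints ≤ r
        orthogonal  : ∀ {u} → u ∈ker Φ → u ∈ker constraints →
                      ∀ f → Member 𝒜 f → form f vector u ≈ 0#

    record PrescribableFamily (𝒜 : Subspace (Λ U) a) (Φ : List (LinearFunctional U)) (n : ℕ) :
                               Set (c ⊔ ℓ ⊔ m ⊔ ℓm ⊔ a) where
      field
        vectors     : Vector Carrierᴹ n
        vectors∈ker : ∀ i → vectors i ∈ker Φ
        witnesses   : Vector (LinearFunctional U) n
        triangular  : Triangular vectors witnesses
        -- The newest vector has index 0; listing it second makes its values with the
        -- older ones those of the map f ↦ (f(w_j,u))_j itself.
        prescribe   : ∀ (g : Fin n → Fin n → F) → ∃[ f ] Member 𝒜 f ×
                      (∀ {i j} → i Fin.< j → form f (vectors j) (vectors i) ≈ g i j)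

    ≈-decidable : ∀ a → ExcludedMiddle (c ⊔ ℓ ⊔ m ⊔ ℓm ⊔ a) → Decidable _≈_
    ≈-decidable a em _ _ = lowerExcludedMiddle ℓ (c ⊔ m ⊔ ℓm ⊔ a) em

    module _ (isField : IsField 𝔽) where

      -- A pair at which some h ∈ 𝒜 does not vanish is removed at the cost of the
      -- functional h v: up to a multiple of h, every form in 𝒜 vanishes at the pair.
      orthogonalityConstraints :
        ExcludedMiddle (c ⊔ ℓ ⊔ m ⊔ ℓm ⊔ a) →
        (𝒜 : Subspace (Λ U) a) (S : Carrierᴹ → Set p) →
        ∀ v ρ →
        (∀ f → Member 𝒜 f → Vanishes f ρ → ∀ {u} → S u → form f v u ≈ 0#) →
        Σ[ Ψ ∈ List (LinearFunctional U) ] length Ψ ≤ length ρ ×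
          (∀ {u} → S u → u ∈ker Ψ → ∀ f → Member 𝒜 f → form f v u ≈ 0#)
      orthogonalityConstraints em 𝒜 S v [] fv≈0 = [] , z≤n , λ u∈S _ f f∈ → fv≈0 f f∈ [] u∈S
      orthogonalityConstraints {a = a} em 𝒜 S v ((x , y) ∷ ρ) fv≈0
        with em {∃[ f ] Member 𝒜 f × ¬ form f x y ≈ 0#}
      -- Every form in `𝒜` already vanishes at the pair, so it is discharged at no cost.
      ... | no vanishing =
        let (Ψ , Ψ≤ , Ψ⇒) = orthogonalityConstraints em 𝒜 S v ρ λ f f∈ fρ≈0 → fv≈0 f f∈
              (decidable-stable (≈-decidable a em (form f x y) 0#)
                (λ fxy≉0 → vanishing (f , f∈ , fxy≉0)) ∷ fρ≈0)
        in Ψ , ℕ.m≤n⇒m≤1+n Ψ≤ , Ψ⇒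
      ... | yes (h , h∈ , hxy≉0) =
        let (Ψ , Ψ≤ , Ψ⇒) = orthogonalityConstraints em (vanishingAt 𝒜 x y) S v ρ
              λ f (f∈ , fxy≈0) fρ≈0 → fv≈0 f f∈ (fxy≈0 ∷ fρ≈0)
        in rightFunctional h v ∷ Ψ , s≤s Ψ≤ , λ { {u} u∈S (hvu≈0 ∷ u∈Ψ) f f∈ →
          let (k , khxy+fxy≈0) = affine-root isField hxy≉0 (form f x y) 0# in begin
            form f v u                  ≈⟨ +-identityˡ _ ⟨
            0# + form f v u             ≈⟨ +-congʳ (trans (*-congˡ hvu≈0) (zeroʳ k)) ⟨
            k · form h v u + form f v u ≈⟨ Ψ⇒ u∈S u∈Ψ (+-form (*-form k h) f)
                                             ( Subspace.+-mem 𝒜 (Subspace.*-mem 𝒜 k h∈) f∈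
                                             , khxy+fxy≈0) ⟩
            0#                          ∎ }
        where open SetoidReasoning setoid

      -- Separating a family by one vector.

      module _ {a} (em : ExcludedMiddle (c ⊔ ℓ ⊔ m ⊔ ℓm ⊔ a))
               (𝒜 : Subspace (Λ U) a) (Φ₀ : List (LinearFunctional U)) (r : ℕ) where

        private
          module 𝒜 = Subspace 𝒜

        -- The map `f ↦ (f(w_i, u))_i`, on the forms of `𝒜` vanishing on `ρ`, is onto the coordinate
        -- space.
        Separating : Vector Carrierᴹ n → List (LinearFunctional U) →
          List (Carrierᴹ × Carrierᴹ) → Set (c ⊔ ℓ ⊔ m ⊔ ℓm ⊔ a)
        Separating {n = n} w Φ ρ = Σ[ u ∈ Carrierᴹ ] u ∈ker Φ₀ × u ∈ker Φ ×
          (∀ (d : Vector F n) →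
            ∃[ f ] Member 𝒜 f × Vanishes f ρ × (∀ i → form f (w i) u ≈ d i))

        -- The summand `n * suc n` is the budget still to be spent: a step with `i` vectors adds `i`
        -- functionals to `Φ` and `i` pairs to `ρ`, and the numbers `2i` for `i ≤ n` sum to
        -- `n(n+1)`.
        separate : ∀ {n} (w : Vector Carrierᴹ n) (p : Vector (LinearFunctional U) n) →
          Triangular w p →
          (∀ i → w i ∈ker Φ₀) → ∀ Φ ρ →
          (length Φ ℕ.+ length ρ) ℕ.+ n * suc n ≤ r →
          ThinVector 𝒜 Φ₀ r ⊎ Separating w Φ ρ
        separate {zero} w p tri w∈ Φ ρ size≤ =
          inj₂ (0ᴹ , ker-0 Φ₀ , ker-0 Φ ,
                λ d → 0-form , 𝒜.0-mem , All.universal (λ _ → refl) ρ , λ ())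
        separate {suc n} w p tri w∈ Φ ρ size≤
          with em {∃[ f ] Member 𝒜 f × Vanishes f ρ ×
                   (∃[ u ] u ∈ker Φ₀ × u ∈ker Φ × ¬ form f (w zero) u ≈ 0#)}
        -- No admissible form sees `w zero`, so this vector is thin: its constraints are `Φ` and at
        -- most `length ρ` functionals that replace the condition of vanishing on `ρ`.
        ... | no orthogonal =
          let (Ψ , Ψ≤ , Ψ⇒) = orthogonalityConstraints em 𝒜 (λ u → u ∈ker Φ₀ × u ∈ker Φ)
                (w zero) ρ λ f f∈ fρ≈0 {u} (u∈Φ₀ , u∈Φ) →
                  decidable-stable (≈-decidable a em (form f (w zero) u) 0#)
                    λ fw₀u≉0 → orthogonal (f , f∈ , fρ≈0 , u , u∈Φ₀ , u∈Φ , fw₀u≉0)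
          in inj₁ record
            { vector      = w zero
            ; vector∈ker  = w∈ zero
            ; witness     = p zero
            ; nonzero     = diagonal tri zero
            ; constraints = Φ ++ Ψ
            ; length≤     = begin
                length (Φ ++ Ψ)                               ≡⟨ length-++ Φ ⟩
                length Φ ℕ.+ length Ψ                         ≤⟨ ℕ.+-monoʳ-≤ (length Φ) Ψ≤ ⟩
                length Φ ℕ.+ length ρ                         ≤⟨ ℕ.m≤m+n _ _ ⟩
                (length Φ ℕ.+ length ρ) ℕ.+ suc n * suc (suc n) ≤⟨ size≤ ⟩
                r                                             ∎
            ; orthogonal  = λ u∈Φ₀ u∈ → Ψ⇒ (u∈Φ₀ , ++⁻ˡ Φ u∈) (++⁻ʳ Φ u∈)
            }
          where open ℕ.≤-Reasoning
        ... | yes (h , h∈ , hρ≈0 , x , x∈Φ₀ , x∈Φ , hw₀x≉0) =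
          case separate w′ (p ∘ suc) (triangular-pivot γ tri) (pivot-∈ker γ w∈) Φ′ ρ′ size≤′
            of λ where
              (inj₁ thin) → inj₁ thin
              (inj₂ separating) → inj₂ (extend separating)
          where
          cleared = annihilating-pivot isField w (leftFunctional h x) hw₀x≉0
          γ = proj₁ cleared
          w′ = pivot {M = U} w γ
          -- Both conditions are imposed at every old `w i`, the pivot included, and hence hold at
          -- each vector of `w′` too.
          Φ′ = tabulate (λ i → rightFunctional h (w i)) ++ Φ
          ρ′ = tabulate (λ i → w i , x) ++ ρ

          size≤′ : (length Φ′ ℕ.+ length ρ′) ℕ.+ n * suc n ≤ r
          size≤′ = begin
            (length Φ′ ℕ.+ length ρ′) ℕ.+ n * suc n
              ≡⟨ ≡.cong₂ (λ l l′ → (l ℕ.+ l′) ℕ.+ n * suc n)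
                   (≡.trans (length-++ (tabulate (λ i → rightFunctional h (w i))))
                     (≡.cong (ℕ._+ length Φ) (length-tabulate (λ i → rightFunctional h (w i)))))
                   (≡.trans (length-++ (tabulate (λ i → w i , x)))
                     (≡.cong (ℕ._+ length ρ) (length-tabulate (λ i → w i , x)))) ⟩
            ((suc n ℕ.+ length Φ) ℕ.+ (suc n ℕ.+ length ρ)) ℕ.+ n * suc n
              ≡⟨ identity n (length Φ) (length ρ) ⟩
            (length Φ ℕ.+ length ρ) ℕ.+ suc n * suc (suc n)
              ≤⟨ size≤ ⟩
            r ∎
            where
            open ℕ.≤-Reasoning
            identity : ∀ n x y → ((suc n ℕ.+ x) ℕ.+ (suc n ℕ.+ y)) ℕ.+ n * suc n
                               ≡ (x ℕ.+ y) ℕ.+ suc n * suc (suc n)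
            identity = ℕSolver.solve-∀

          extend : Separating w′ Φ′ ρ′ → Separating w Φ ρ
          extend (y , y∈Φ₀ , y∈Φ′ , prescribe) =
            u , ker-+ x∈Φ₀ y∈Φ₀ , ker-+ x∈Φ (++⁻ʳ _ y∈Φ′) , realise
            where
            open SetoidReasoning setoid
            u = x +ᴹ y

            hwy≈0 : ∀ i → form h (w i) y ≈ 0#
            hwy≈0 = tabulate⁻ {f = λ i → rightFunctional h (w i)} (++⁻ˡ _ y∈Φ′)

            realise : ∀ d → ∃[ f ] Member 𝒜 f × Vanishes f ρ × (∀ i → form f (w i) u ≈ d i)
            realise d =
              -- The value requested at `w′ i` is what linearity forces once the values at `w` are
              -- `d`.
              let (f′ , f′∈ , f′ρ′≈0 , f′w′y≈) = prescribe (λ i → d (suc i) + γ i · d zero)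
                  -- Since `h` vanishes at each `(w′ i, x)`, the multiple `k` can correct the value
                  -- at `w zero` without disturbing those at `w′`.
                  (k , k-root) = affine-root isField hw₀x≉0 (form f′ (w zero) y) (d zero)
                  f = +-form (*-form k h) f′
                  f′wx≈0 : ∀ i → form f′ (w i) x ≈ 0#
                  f′wx≈0 = tabulate⁻ (++⁻ˡ _ f′ρ′≈0)

                  cross-free : ∀ z → form h z y ≈ 0# → form f′ z x ≈ 0# →
                    form f z u ≈ k · form h z x + form f′ z y
                  cross-free z hzy≈0 f′zx≈0 = begin
                    k · form h z u + form f′ z u
                      ≈⟨ +-cong (*-congˡ (AlternatingForm.+-linearʳ h _ _ _))
                                (AlternatingForm.+-linearʳ f′ _ _ _) ⟩
                    k · (form h z x + form h z y) + (form f′ z x + form f′ z y)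
                      ≈⟨ +-cong (*-congˡ (+-congˡ hzy≈0)) (+-congʳ f′zx≈0) ⟩
                    k · (form h z x + 0#) + (0# + form f′ z y)
                      ≈⟨ +-cong (*-congˡ (+-identityʳ _)) (+-identityˡ _) ⟩
                    k · form h z x + form f′ z y ∎

                  pivot-zero : (φ : LinearFunctional U) → (∀ i → apply φ (w i) ≈ 0#) →
                    ∀ i → apply φ (w′ i) ≈ 0#
                  pivot-zero φ φw≈0 i = LinearFunctional.+-zero φ (φw≈0 (suc i))
                    (LinearFunctional.*-zero φ (γ i) (φw≈0 zero))

                  fw₀u≈ : form f (w zero) u ≈ d zero
                  fw₀u≈ = trans (cross-free (w zero) (hwy≈0 zero) (f′wx≈0 zero)) k-root

                  fw′u≈ : ∀ i → form f (w′ i) u ≈ d (suc i) + γ i · d zero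
                  fw′u≈ i = begin
                    form f (w′ i) u
                      ≈⟨ cross-free (w′ i) (pivot-zero (leftFunctional h y) hwy≈0 i)
                                           (pivot-zero (leftFunctional f′ x) f′wx≈0 i) ⟩
                    k · form h (w′ i) x + form f′ (w′ i) y
                      ≈⟨ +-cong (trans (*-congˡ (proj₂ cleared i)) (zeroʳ k)) (f′w′y≈ i) ⟩
                    0# + (d (suc i) + γ i · d zero)
                      ≈⟨ +-identityˡ _ ⟩
                    d (suc i) + γ i · d zero ∎
              in f , 𝒜.+-mem (𝒜.*-mem k h∈) f′∈
                , All.zipWith (λ { (h≈0 , f′≈0) →
                      trans (+-cong (trans (*-congˡ h≈0) (zeroʳ k)) f′≈0) (+-identityˡ 0#) })
                    (hρ≈0 , ++⁻ʳ _ f′ρ′≈0)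
                , λ { zero → fw₀u≈
                    -- Undo the pivot: cancelling the contribution of `w zero` recovers the value at
                    -- `w (suc i)`.
                    ; (suc i) → +-cancelʳ (γ i · d zero) _ _ (begin
                        form f (w (suc i)) u + γ i · d zero
                          ≈⟨ +-congˡ (*-congˡ fw₀u≈) ⟨
                        form f (w (suc i)) u + γ i · form f (w zero) u
                          ≈⟨ LinearFunctional.+*-homo (leftFunctional f u) _ _ _ ⟨
                        form f (w′ i) u
                          ≈⟨ fw′u≈ i ⟩
                        d (suc i) + γ i · d zero ∎) }

        -- Growing a prescribable family.

        extendFamily : PrescribableFamily 𝒜 Φ₀ (suc n) → 2 * (suc n * suc (suc n)) ≤ r →
          ThinVector 𝒜 Φ₀ r ⊎ PrescribableFamily 𝒜 Φ₀ (suc (suc n))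
        extendFamily {n} family size≤ =
          case separate W.vectors W.witnesses W.triangular W.vectors∈ker Φ ρ size≤′ of λ where
            (inj₁ thin) → inj₁ thin
            (inj₂ separating) → inj₂ (extend separating)
          where
          module W = PrescribableFamily family
          -- Old witnesses vanishing at the new vector keep the family triangular; correcting forms
          -- vanishing on all old pairs preserve the values already prescribed.
          Φ = tabulate W.witnesses
          ρ = cartesianProduct (tabulate W.vectors) (tabulate W.vectors)

          size≤′ : (length Φ ℕ.+ length ρ) ℕ.+ suc n * suc (suc n) ≤ r
          size≤′ = begin
            (length Φ ℕ.+ length ρ) ℕ.+ suc n * suc (suc n)
              ≡⟨ ≡.cong₂ (λ l l′ → (l ℕ.+ l′) ℕ.+ suc n * suc (suc n))
                   (length-tabulate W.witnesses)
                   (≡.trans (length-cartesianProduct (tabulate W.vectors) (tabulate W.vectors))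
                     (≡.cong₂ _*_ (length-tabulate W.vectors) (length-tabulate W.vectors))) ⟩
            (suc n ℕ.+ suc n * suc n) ℕ.+ suc n * suc (suc n)
              ≡⟨ identity (suc n) ⟩
            2 * (suc n * suc (suc n))
              ≤⟨ size≤ ⟩
            r ∎
            where
            open ℕ.≤-Reasoning
            -- A family of size `k` costs `k` witnesses, `k * k` pairs, and `k * suc k` for the
            -- elimination.
            identity : ∀ k → (k ℕ.+ k * k) ℕ.+ k * suc k ≡ 2 * (k * suc k)
            identity = ℕSolver.solve-∀

          extend : Separating W.vectors Φ ρ → PrescribableFamily 𝒜 Φ₀ (suc (suc n))
          extend (u , u∈Φ₀ , u∈Φ , separates) = record
            { vectors     = u Vector.∷ W.vectors
            ; vectors∈ker = λ { zero → u∈Φ₀ ; (suc i) → W.vectors∈ker i }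
            ; witnesses   = rightFunctional h w₀ Vector.∷ W.witnesses
            ; triangular  = triangular-∷
                (λ hw₀u≈0 → IsField.1≉0 isField (trans (sym (hwu≈1 zero)) hw₀u≈0))
                (tabulate⁻ {f = W.witnesses} u∈Φ) W.triangular
            ; prescribe   = prescribe
            }
            where
            open SetoidReasoning setoid
            w₀ = W.vectors zero

            -- The value 1 at `(w₀, u)` makes `h(w₀, -)` a functional nonzero at `u`, which serves
            -- as the new witness.
            h = proj₁ (separates λ _ → 1#)
            hwu≈1 : ∀ i → form h (W.vectors i) u ≈ 1#
            hwu≈1 = proj₂ (proj₂ (proj₂ (separates λ _ → 1#)))

            prescribe : ∀ g → ∃[ f ] Member 𝒜 f × (∀ {i j} → i Fin.< j →
              form f ((u Vector.∷ W.vectors) j) ((u Vector.∷ W.vectors) i) ≈ g i j)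
            prescribe g =
              -- `f₁` settles the old pairs; `f₂` vanishes on them and corrects the pairs with `u`.
              let (f₁ , f₁∈ , f₁≈g) = W.prescribe (λ i j → g (suc i) (suc j))
                  (f₂ , f₂∈ , f₂ρ≈0 , f₂wu≈) = separates
                    λ j → - form f₁ (W.vectors j) u + g zero (suc j)
              in +-form f₁ f₂ , 𝒜.+-mem f₁∈ f₂∈ , λ
                { {zero} {suc j} _ → begin
                  form f₁ (W.vectors j) u + form f₂ (W.vectors j) u
                    ≈⟨ +-congˡ (f₂wu≈ j) ⟩
                  form f₁ (W.vectors j) u + (- form f₁ (W.vectors j) u + g zero (suc j))
                    ≈⟨ \\-leftDividesˡ (form f₁ (W.vectors j) u) (g zero (suc j)) ⟩
                  g zero (suc j) ∎
                ; {suc i} {suc j} (s≤s i<j) → begin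
                  form f₁ (W.vectors j) (W.vectors i) + form f₂ (W.vectors j) (W.vectors i)
                    ≈⟨ +-cong (f₁≈g i<j) (All.lookup f₂ρ≈0
                         (∈-cartesianProduct⁺ (∈-tabulate⁺ {f = W.vectors} j)
                                              (∈-tabulate⁺ {f = W.vectors} i))) ⟩
                  g (suc i) (suc j) + 0#
                    ≈⟨ +-identityʳ _ ⟩
                  g (suc i) (suc j) ∎ }

        -- Every extension starts with a fresh budget and the last one is the dearest, so a single
        -- bound on `r` covers them all.
        growFamily : HasDimension U n → length Φ₀ < n → ∀ k → 2 * (k * suc k) ≤ r →
          ThinVector 𝒜 Φ₀ r ⊎ PrescribableFamily 𝒜 Φ₀ (suc k)
        growFamily dimension Φ₀<n zero size≤ =
          -- One nonzero vector of the kernel starts the family; there is no pair to prescribe yet.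
          let (x , φ , φx≉0 , x∈Φ₀ , _) = common-zero isField (≈-decidable a em) Φ₀ []
                (coordinates-triangular isField dimension) (λ _ → []) Φ₀<n
          in inj₂ record
            { vectors     = λ _ → x
            ; vectors∈ker = λ _ → x∈Φ₀
            ; witnesses   = λ _ → φ
            ; triangular  = record { diagonal = λ _ → φx≉0 ; upper = λ { {zero} {zero} () } }
            ; prescribe   = λ _ → 0-form , 𝒜.0-mem , λ { {zero} {zero} () }
            }
        growFamily dimension Φ₀<n (suc k) size≤ =
          case growFamily dimension Φ₀<n k (ℕ.≤-trans
            (ℕ.*-monoʳ-≤ 2 (ℕ.*-mono-≤ (ℕ.n≤1+n k) (ℕ.n≤1+n (suc k)))) size≤) of λ where
            (inj₁ thin)   → inj₁ thin
            (inj₂ family) → extendFamily family size≤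

      -- Isotropic flags of thin vectors.

      -- Each vector accounts for `suc r` constraints: at most `r` for its thinness and one for its
      -- witness. New vectors are taken from the kernel of `constraints`, where `witnesses⊆` and
      -- `orthogonal` give triangularity and isotropy.
      record IsotropicFlag (𝒜 : Subspace (Λ U) a) (r n : ℕ) : Set (c ⊔ ℓ ⊔ m ⊔ ℓm ⊔ a) where
        field
          vectors     : Vector Carrierᴹ n
          witnesses   : Vector (LinearFunctional U) n
          triangular  : Triangular vectors witnesses
          isotropic   : ∀ f → Member 𝒜 f → ∀ {i j} → i Fin.< j →
                        form f (vectors j) (vectors i) ≈ 0#
          constraints : List (LinearFunctional U)
          length≤     : length constraints ≤ n * suc r
          witnesses⊆  : ∀ {u} → u ∈ker constraints → ∀ i → apply (witnesses i) u ≈ 0#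
          orthogonal  : ∀ {u} → u ∈ker constraints → ∀ f → Member 𝒜 f →
                        ∀ i → form f (vectors i) u ≈ 0#

      extendFlag : ∀ {𝒜 : Subspace (Λ U) a} {r} (flag : IsotropicFlag 𝒜 r n) →
        ThinVector 𝒜 (IsotropicFlag.constraints flag) r → IsotropicFlag 𝒜 r (suc n)
      extendFlag {n = n} {r = r} flag thin = record
        { vectors     = T.vector Vector.∷ V.vectors
        ; witnesses   = T.witness Vector.∷ V.witnesses
        ; triangular  = triangular-∷ T.nonzero (V.witnesses⊆ T.vector∈ker) V.triangular
        ; isotropic   = λ { f f∈ {zero} {suc j} _ → V.orthogonal T.vector∈ker f f∈ j
                          ; f f∈ {suc i} {suc j} (s≤s i<j) → V.isotropic f f∈ i<j }
        ; constraints = T.witness ∷ T.constraints ++ V.constraints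
        ; length≤     = s≤s (begin
            length (T.constraints ++ V.constraints)        ≡⟨ length-++ T.constraints ⟩
            length T.constraints ℕ.+ length V.constraints ≤⟨ ℕ.+-mono-≤ T.length≤ V.length≤ ⟩
            r ℕ.+ n * suc r                                ∎)
        ; witnesses⊆  = λ { (w≈0 ∷ u∈) zero → w≈0
                          ; (w≈0 ∷ u∈) (suc i) → V.witnesses⊆ (++⁻ʳ T.constraints u∈) i }
        ; orthogonal  = λ { (_ ∷ u∈) f f∈ zero →
                              T.orthogonal (++⁻ʳ T.constraints u∈) (++⁻ˡ T.constraints u∈) f f∈
                          ; (_ ∷ u∈) f f∈ (suc i) →
                              V.orthogonal (++⁻ʳ T.constraints u∈) f f∈ i }
        }
        where
        module V = IsotropicFlag flag
        module T = ThinVector thin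
        open ℕ.≤-Reasoning

      -- A flag of `s` vectors has at most `s * suc r` constraints, fewer than `n` while another
      -- vector is wanted, so their kernel has a nonzero vector with which `growFamily` can start.
      flag-or-family : ExcludedMiddle (c ⊔ ℓ ⊔ m ⊔ ℓm ⊔ a) → (𝒜 : Subspace (Λ U) a) →
        HasDimension U n → ∀ k r → 2 * (k * suc k) ≤ r → ∀ s → s * suc r ≤ n →
        IsotropicFlag 𝒜 r s ⊎ ∃[ Φ ] PrescribableFamily 𝒜 Φ (suc k)
      flag-or-family em 𝒜 dimension k r size≤ zero _ = inj₁ record
        { vectors     = λ ()
        ; witnesses   = λ ()
        ; triangular  = triangular-[]
        ; isotropic   = λ { _ _ {()} }
        ; constraints = []
        ; length≤     = z≤n
        ; witnesses⊆  = λ _ ()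
        ; orthogonal  = λ _ _ _ ()
        }
      flag-or-family em 𝒜 dimension k r size≤ (suc s) s*r≤n =
        case flag-or-family em 𝒜 dimension k r size≤ s
               (ℕ.≤-trans (ℕ.m≤n+m (s * suc r) (suc r)) s*r≤n) of λ where
          (inj₂ family) → inj₂ family
          (inj₁ flag) →
            case growFamily em 𝒜 (IsotropicFlag.constraints flag) r dimension
                   -- Strictness comes from the additional one in `suc r`.
                   (ℕ.≤-trans (s≤s (IsotropicFlag.length≤ flag))
                     (ℕ.≤-trans (s≤s (ℕ.m≤n+m (s * suc r) r)) s*r≤n)) k size≤ of λ where
              (inj₁ thin)   → inj₁ (extendFlag flag thin)
              (inj₂ family) → inj₂ (_ , family)

      -- From flags and families to subspaces.

      flag⇒zero-restriction : ∀ {𝒜 : Subspace (Λ U) a} {r s} → IsotropicFlag 𝒜 r s →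
        Σ[ V ∈ Subspace U (c ⊔ ℓm) ] HasDimension ⟦ V ⟧ s × IsZeroSpace (𝒜 ∣ V)
      flag⇒zero-restriction {𝒜 = 𝒜} flag = V , dimension , (λ {g} → to {g}) , (λ {g} → from {g})
        where
        module V = IsotropicFlag flag
        V = span V.vectors
        dimension = span-dimension {M = U} (triangular⇒independent isField V.triangular)

        to : ∀ {g} → Member (𝒜 ∣ V) g → ∀ x y → form g x y ≈ 0#
        to (f , f∈ , f≈g) x y = trans (sym (f≈g x y))
          (form-ext ⟦ V ⟧ (proj₂ (proj₂ dimension)) (restrictForm f V) 0-form
            (λ i j i<j → V.isotropic f f∈ i<j) x y)

        from : ∀ {g} → (∀ x y → form g x y ≈ 0#) → Member (𝒜 ∣ V) g
        from g≈0 = 0-form , Subspace.0-mem 𝒜 , λ x y → sym (g≈0 x y)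

      -- Some member of `𝒜` matches a given form on one triangle of its Gram matrix, and `form-ext`
      -- spreads the agreement to the whole span.
      family⇒whole-restriction : ∀ {𝒜 : Subspace (Λ U) a} {Φ t} → PrescribableFamily 𝒜 Φ t →
        Σ[ W ∈ Subspace U (c ⊔ ℓm) ] HasDimension ⟦ W ⟧ t × IsWholeSpace (𝒜 ∣ W)
      family⇒whole-restriction {𝒜 = 𝒜} family = W , dimension , λ g →
        let b = proj₁ dimension
            (f , f∈ , f≈g) = W.prescribe (λ i j → form g (b j) (b i))
        in f , f∈ , form-ext ⟦ W ⟧ (proj₂ (proj₂ dimension)) (restrictForm f W) g
                      (λ i j i<j → f≈g i<j)
        where
        module W = PrescribableFamily family
        W = span W.vectors
        dimension = span-dimension {M = U} (triangular⇒independent isField W.triangular)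

-- The numerical bound and the conclusion.

1+2k[1+k]≤[1+k]^4 : ∀ k → suc (2 * (k * suc k)) ≤ suc k ^ 4
1+2k[1+k]≤[1+k]^4 k = ℕ.≤-trans (ℕ.m≤m+n _ _) (ℕ.≤-reflexive (expansion k))
  where
  -- The bracketed summand is the difference of the two sides, a polynomial in `k` without negative
  -- coefficients.
  expansion : ∀ k → suc (2 * (k * suc k)) ℕ.+
                    (2 * k ℕ.+ 4 * (k * k) ℕ.+ 4 * (k * k * k) ℕ.+ k * k * k * k)
                  ≡ suc k * (suc k * (suc k * (suc k * 1)))
  expansion = ℕSolver.solve-∀

theorem1p1 : ∀ {c ℓ m ℓm a : Level} →
    ExcludedMiddle (c ⊔ ℓ ⊔ m ⊔ ℓm ⊔ a) →
    (𝔽 : CommutativeRing c ℓ) → IsField 𝔽 →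
    (s t : ℕ) → 2 ≤ s → 2 ≤ t →
    (n : ℕ) → s * t ^ 4 ≤ n →
    (U : VectorSpace 𝔽 m ℓm) → HasDimension U n →
    (𝒜 : Subspace (Λ U) a) →
    (Σ[ V ∈ Subspace U (c ⊔ ℓm) ] HasDimension ⟦ V ⟧ s × IsZeroSpace (𝒜 ∣ V))
    ⊎ (Σ[ W ∈ Subspace U (c ⊔ ℓm) ] HasDimension ⟦ W ⟧ t × IsWholeSpace (𝒜 ∣ W))
theorem1p1 em 𝔽 isField s (suc k) 2≤s 2≤t n st⁴≤n U dimension 𝒜 =
  -- With `t = suc k`, a family of size `t` needs exactly the budget `r = 2 * (k * suc k)`, and
  -- `suc r ≤ t ^ 4`.
  case flag-or-family isField em 𝒜 dimension k (2 * (k * suc k)) ℕ.≤-refl s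
         (ℕ.≤-trans (ℕ.*-monoʳ-≤ s (1+2k[1+k]≤[1+k]^4 k)) st⁴≤n) of λ where
    (inj₁ flag)         → inj₁ (flag⇒zero-restriction isField flag)
    (inj₂ (_ , family)) → inj₂ (family⇒whole-restriction isField family)
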